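{- Let $\Gamma$ be a constraint language such that $\mathrm{Pol}(\Gamma)=[\bar{x}]$. Then $\mathrm{ABD}(\Gamma\cup\{\bot,\top\})\le^{\mathrm{CV}}\mathrm{ABD}(\Gamma)$ and $\mathrm{ABD}(\Gamma)\le^{\mathrm{CV}}\mathrm{ABD}(\Gamma\cup\{\bot,\top\})$, and likewise $\mathrm{P\text{ - }ABD}(\Gamma\cup\{\bot,\top\})$ and $\mathrm{P\text{ - }ABD}(\Gamma)$ are CV-reducible to each other.
   Context: A constraint language $\Gamma$ is a set of relations $R\subseteq\{0,1\}^k$; $\bot=\{(0)\}$, $\top=\{(1)\}$. An operation $f\colon\{0,1\}^m\to\{0,1\}$ is a polymorphism of $R$ if applying $f$ coordinatewise to any $m$ tuples of $R$ yields a tuple of $R$; $\mathrm{Pol}(\Gamma)$ is the set of operations that are polymorphisms of every relation of $\Gamma$. $[\bar{x}]$ denotes the clone generated by Boolean negation $x\mapsto\neg x$, i.e. the set of all projections and negated projections. An instance of $\mathrm{ABD}(\Gamma)$ is $(\mathrm{KB},H,M)$, $\mathrm{KB}$ a $\Gamma$-formula, $H,M$ sets of variables; it asks whether there is $E\subseteq H\cup\{\neg x:x\in H\}$ with $\mathrm{KB}\wedge E$ satisfiable and $\mathrm{KB}\wedge E\models m$ for all $m\in M$; $\mathrm{P\text{ - }ABD}(\Gamma)$ additionally requires $E\subseteq H$. A CV-reduction $A\le^{\mathrm{CV}}B$ is a polynomial-time map $f$ with $I\in A\iff f(I)\in B$ and $|\mathrm{var}(f(I))|\le|\mathrm{var}(I)|+O(1)$.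 -}

module Defs where

open import Data.Bool.Base using (Bool; true; false; not)
import Data.Bool.Properties as Bool
open import Data.Fin.Base using (Fin; fromℕ)
open import Data.List.Base using (List; []; _∷_; _++_; [_]; map; concatMap; length; reverse; catMaybes; deduplicate)
open import Data.List.Membership.Propositional using (_∈_)
open import Data.List.Properties using (≡-dec)
open import Data.List.Relation.Binary.Subset.Propositional using (_⊆_)
open import Data.List.Relation.Unary.All using (All)
open import Data.Maybe.Base using (Maybe; just; nothing)
import Data.Maybe.Base as Maybe
open import Data.Nat.Base using (ℕ; suc; _+_; _*_; _^_; _≤_)
open import Data.Product.Base using (∃-syntax; Σ-syntax; _×_; _,_)
open import Data.Vec.Base as Vec using (Vec; []; _∷_)
import Data.Vec.Relation.Unary.All as VecAll
open import Function.Base using (_∘_)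
open import Function.Bundles using (_⇔_)
open import Relation.Binary.Definitions using (DecidableEquality)
open import Relation.Binary.PropositionalEquality using (_≡_; _≗_)

Relation : ℕ → Set
Relation k = Vec Bool k → Bool

infix 4 _∈ʳ_

_∈ʳ_ : ∀ {k} → Vec Bool k → Relation k → Set
t ∈ʳ R = R t ≡ true

Language : Set₁
Language = (k : ℕ) → Relation k → Set

⊥ʳ ⊤ʳ : Relation 1
⊥ʳ (x ∷ []) = not x
⊤ʳ (x ∷ []) = x

data _∪⊥⊤ (Γ : Language) : Language where
  old : ∀ {k} {R : Relation k} → Γ k R → (Γ ∪⊥⊤) k R
  bot : ∀ {R : Relation 1} → R ≗ ⊥ʳ → (Γ ∪⊥⊤) 1 R
  top : ∀ {R : Relation 1} → R ≗ ⊤ʳ → (Γ ∪⊥⊤) 1 R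

Operation : ℕ → Set
Operation m = Vec Bool m → Bool

OperationSet : Set₁
OperationSet = (m : ℕ) → Operation m → Set

infix 4 _≐_

_≐_ : OperationSet → OperationSet → Set
F ≐ G = ∀ m (f : Operation m) → F m f ⇔ G m f

_IsPolymorphismOf_ : ∀ {m k} → Operation m → Relation k → Set
_IsPolymorphismOf_ {m} {k} f R =
  (ts : Vec (Vec Bool k) m) → VecAll.All (_∈ʳ R) ts → Vec.map f (Vec.transpose ts) ∈ʳ R

Pol : Language → OperationSet
Pol Γ m f = ∀ k (R : Relation k) → Γ k R → f IsPolymorphismOf R

data Clone (F : OperationSet) : OperationSet where
  gen  : ∀ {m} {f : Operation m} → F m f → Clone F m f
  proj : ∀ {m} (i : Fin m) → Clone F m (λ xs → Vec.lookup xs i)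
  comp : ∀ {m n} {f : Operation n} {g : Fin n → Operation m} →
         Clone F n f → (∀ i → Clone F m (g i)) →
         Clone F m (λ xs → f (Vec.tabulate (λ i → g i xs)))
  -- Function extensionality is not available, so closure under pointwise
  -- equality is what makes this a set of functions.
  ext  : ∀ {m} {f g : Operation m} → f ≗ g → Clone F m f → Clone F m g

data Negation : OperationSet where
  negation : Negation 1 (λ xs → not (Vec.head xs))

[x̄] : OperationSet
[x̄] = Clone Negation

-- Variable names are binary words.
Var : Set
Var = List Bool

_≟ᵛ_ : DecidableEquality Var
_≟ᵛ_ = ≡-dec Bool._≟_

-- Γ may be infinite, so a constraint carries its relation explicitly, as a
-- list of its tuples (in any order, repetitions allowed).
record Constraint (Γ : Language) : Set where
  field
    arity    : ℕ
    relation : Relation arity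
    inΓ      : Γ arity relation
    tuples   : List (Vec Bool arity)
    listing  : ∀ t → (t ∈ tuples) ⇔ (t ∈ʳ relation)
    scope    : Vec Var arity

Formula : Language → Set
Formula Γ = List (Constraint Γ)

data Literal : Set where
  pos neg : Var → Literal

Assignment : Set
Assignment = Var → Bool

infix 4 _⊨ᶜ_ _⊨_ _⊨ˡ_

_⊨ᶜ_ : ∀ {Γ} → Assignment → Constraint Γ → Set
σ ⊨ᶜ C = Vec.map σ (Constraint.scope C) ∈ʳ Constraint.relation C

_⊨_ : ∀ {Γ} → Assignment → Formula Γ → Set
σ ⊨ φ = All (σ ⊨ᶜ_) φ

_⊨ˡ_ : Assignment → Literal → Set
σ ⊨ˡ pos x = σ x ≡ true
σ ⊨ˡ neg x = σ x ≡ false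

record Instance (Γ : Language) : Set where
  field
    KB : Formula Γ
    H  : List Var
    M  : List Var

module _ {Γ : Language} (I : Instance Γ) where
  open Instance I

  ModelWith : List Literal → Assignment → Set
  ModelWith E σ = (σ ⊨ KB) × All (σ ⊨ˡ_) E

  Explanation : List Literal → Set
  Explanation E =
    (∃[ σ ] ModelWith E σ) ×
    (∀ m → m ∈ M → ∀ σ → ModelWith E σ → σ ⊨ˡ pos m)

  HasExplanation : Set
  HasExplanation = ∃[ E ] (E ⊆ map pos H ++ map neg H) × Explanation E

  HasPositiveExplanation : Set
  HasPositiveExplanation = ∃[ E ] (E ⊆ map pos H) × Explanation E

  occurrences : List Var
  occurrences = concatMap (Vec.toList ∘ Constraint.scope) KB ++ H ++ M

  -- |var(I)|: the number of distinct variables occurring in KB, H or M.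
  #var : ℕ
  #var = length (deduplicate _≟ᵛ_ occurrences)

data Symbol : Set where
  bit          : Bool → Symbol
  open[ close] : Symbol

bracket : List Symbol → List Symbol
bracket w = open[ ∷ w ++ [ close] ]

encodeWord : List Bool → List Symbol
encodeWord w = bracket (map bit w)

encodeList : ∀ {A : Set} → (A → List Symbol) → List A → List Symbol
encodeList enc xs = bracket (concatMap enc xs)

encodeConstraint : ∀ {Γ} → Constraint Γ → List Symbol
encodeConstraint C = bracket
  (encodeList (encodeWord ∘ Vec.toList) tuples ++ encodeList encodeWord (Vec.toList scope))
  where open Constraint C

encodeInstance : ∀ {Γ} → Instance Γ → List Symbol
encodeInstance I =
  encodeList encodeConstraint KB ++ encodeList encodeWord H ++ encodeList encodeWord M
  where open Instance I

Cell : Set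
Cell = Maybe Symbol

blank : Cell
blank = nothing

-- A two-way infinite tape. `left` lists the cells left of the head, nearest
-- first; cells beyond either list are blank.
record Tape : Set where
  constructor tape
  field
    left  : List Cell
    head  : Cell
    right : List Cell

data Move : Set where
  goLeft stay goRight : Move

move : Move → Tape → Tape
move goLeft  (tape []       h rs)       = tape [] blank (h ∷ rs)
move goLeft  (tape (l ∷ ls) h rs)       = tape ls l (h ∷ rs)
move stay    t                          = t
move goRight (tape ls       h [])       = tape (h ∷ ls) blank []
move goRight (tape ls       h (r ∷ rs)) = tape (h ∷ ls) r rs

act : Cell × Move → Tape → Tape
act (c , m) (tape ls _ rs) = move m (tape ls c rs)

blankTape : Tape
blankTape = tape [] blank []

inputTape : List Symbol → Tape
inputTape []      = blankTape
inputTape (s ∷ w) = tape [] (just s) (map just w)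

-- The nonblank symbols on the tape, from left to right.
contents : Tape → List Symbol
contents (tape ls h rs) = catMaybes (reverse ls ++ h ∷ rs)

record TuringMachine : Set₁ where
  field
    State    : Set
    states   : List State
    complete : ∀ q → q ∈ states
    start    : State
    extra    : ℕ
  tapes : ℕ
  tapes = suc extra
  field
    -- The machine halts where δ is `nothing`.
    δ : State → Vec Cell tapes → Maybe (State × Vec (Cell × Move) tapes)

  Config : Set
  Config = State × Vec Tape tapes

  step : Config → Maybe Config
  step (q , ts) =
    Maybe.map (λ (q′ , as) → q′ , Vec.zipWith act as ts) (δ q (Vec.map Tape.head ts))

  -- Input is on the first tape, output on the last (possibly the same) one.
  initial : List Symbol → Config
  initial w = start , inputTape w ∷ Vec.replicate extra blankTape

  output : Config → List Symbol
  output (_ , ts) = contents (Vec.lookup ts (fromℕ extra))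

  -- c ⇓[ n ] d: started in c, the machine halts in d after at most n steps.
  data _⇓[_]_ : Config → ℕ → Config → Set where
    halt : ∀ {c n} → step c ≡ nothing → c ⇓[ n ] c
    next : ∀ {c c′ d n} → step c ≡ just c′ → c′ ⇓[ n ] d → c ⇓[ suc n ] d

record Problem : Set₁ where
  field
    Inst   : Set
    encode : Inst → List Symbol
    vars   : Inst → ℕ
    Yes    : Inst → Set

ABD P-ABD : Language → Problem
ABD Γ = record
  { Inst   = Instance Γ
  ; encode = encodeInstance
  ; vars   = #var
  ; Yes    = HasExplanation
  }
P-ABD Γ = record
  { Inst   = Instance Γ
  ; encode = encodeInstance
  ; vars   = #var
  ; Yes    = HasPositiveExplanation
  }

module _ (A B : Problem) where
  private
    module A = Problem A
    module B = Problem B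

  PolynomialTime : (A.Inst → B.Inst) → Set₁
  PolynomialTime f =
    Σ[ T ∈ TuringMachine ] Σ[ c ∈ ℕ ] Σ[ d ∈ ℕ ] let open TuringMachine T in
      ∀ I → let w = A.encode I in
        ∃[ e ] (initial w ⇓[ c * length w ^ d + c ] e) × (output e ≡ B.encode (f I))

  record CVReduction : Set₁ where
    field
      f          : A.Inst → B.Inst
      polynomial : PolynomialTime f
      correct    : ∀ I → A.Yes I ⇔ B.Yes (f I)
      fewVars    : ∃[ c ] ∀ I → B.vars (f I) ≤ A.vars I + c

infix 4 _≤CV_

_≤CV_ : Problem → Problem → Set₁
A ≤CV B = CVReduction A B

{-# OPTIONS --safe #-}

-- Negation is a polymorphism of Γ but the constant 0 is not, so some R ∈ Γ is
-- closed under complement, is nonempty and contains neither constant tuple.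
-- Lowering the ones of a tuple of R one at a time, we cross from R to its
-- outside by changing a single coordinate. Plugging two fresh variables t and f
-- into the other coordinates gives R-constraints on one variable x which, when
-- t = 1 and f = 0, say x = 1, respectively (complementing) x = 0; they replace
-- ⊤(x) and ⊥(x). The first of them with x := t forces t ≠ f, and adding t to
-- both H and M makes every explanation entail t. As x occurs once in the new
-- constraint, the reduction is computed in a single left-to-right pass.

module Submission where

open import Defs
open import Axiom.ExcludedMiddle using (ExcludedMiddle)
open import Data.Bool.Base using (Bool; true; false; not; if_then_else_)
open import Data.Bool.Properties using (not-involutive; ¬-not) renaming (_≟_ to _≟ᵇ_)
open import Data.List.Base as List using (List; []; _∷_; _++_; [_]; map; concatMap; length; filter; deduplicate; catMaybes; reverse; cartesianProduct; cartesianProductWith)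
open import Data.List.Extrema.Nat using (max; xs≤max)
open import Data.List.Membership.Propositional using (_∈_)
open import Data.List.Membership.Propositional.Properties
open import Data.List.Properties using (++-assoc; ++-identityʳ; concatMap-++; concatMap-map; length-map; catMaybes-++; mapMaybe-just; unfold-reverse; length-++)
open import Data.List.Relation.Binary.Subset.Propositional using (_⊆_)
open import Data.List.Relation.Unary.All as All using (All; []; _∷_)
import Data.List.Relation.Unary.All.Properties as All
open import Data.List.Relation.Unary.Any using (here; there)
open import Data.List.Relation.Unary.AllPairs using ([]; _∷_)
open import Data.List.Relation.Unary.Unique.DecPropositional.Properties _≟ᵛ_ using (deduplicate-!)
open import Data.List.Relation.Unary.Unique.Propositional using (Unique)
open import Data.Maybe.Base using (Maybe; just; nothing)
open import Data.Nat.Base using (ℕ; zero; suc; _+_; _*_; _^_; _≤_; z≤n; s≤s)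
open import Data.Nat.Properties using (≤-trans; ≤-reflexive; n≤1+n; m≤m+n; +-monoˡ-≤; +-comm; +-suc; *-comm; *-identityʳ)
open import Data.Product.Base using (Σ-syntax; ∃-syntax; _×_; _,_; proj₁; proj₂)
open import Data.Sum.Base using (_⊎_; inj₁; inj₂)
open import Data.Unit.Base using (⊤; tt)
open import Data.Vec.Base as Vec using (Vec; []; _∷_)
import Data.Vec.Properties as Vec
import Data.Vec.Relation.Unary.All as VecAll
open import Function.Base using (_∘_; id; const)
open import Function.Bundles using (_⇔_; mk⇔; Equivalence)
open import Level using (0ℓ)
open import Relation.Binary.PropositionalEquality using (_≡_; _≗_; refl; sym; trans; cong; cong₂; subst; module ≡-Reasoning)
open import Relation.Nullary.Decidable using (Dec; yes; no; does)
open import Relation.Nullary.Negation using (contradiction)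

open Equivalence using (to; from)

-- Finite enumerations and counting

vectors : ∀ {A : Set} → List A → ∀ n → List (Vec A n)
vectors xs zero    = [ [] ]
vectors xs (suc n) = cartesianProductWith _∷_ xs (vectors xs n)

∈-vectors : ∀ {A : Set} {xs : List A} → (∀ x → x ∈ xs) → ∀ {n} (v : Vec A n) → v ∈ vectors xs n
∈-vectors all []      = here refl
∈-vectors all (x ∷ v) = ∈-cartesianProductWith⁺ _∷_ (all x) (∈-vectors all v)

bools : List Bool
bools = true ∷ false ∷ []

∈-bools : ∀ b → b ∈ bools
∈-bools true  = here refl
∈-bools false = there (here refl)

-- Deleting the occurrence of the head from `ys` leaves room for the tail, since by uniqueness the
-- tail does not need that occurrence. This is what turns an inclusion of variables into a bound on
-- `#var`.
Unique-⊆-length : ∀ {A : Set} {xs ys : List A} → Unique xs → xs ⊆ ys → length xs ≤ length ys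
Unique-⊆-length []             _     = z≤n
Unique-⊆-length (x∉xs ∷ uniq) xs⊆ys with ∈-∃++ (xs⊆ys (here refl))
... | us , vs , refl = ≤-trans (s≤s (Unique-⊆-length uniq avoid)) (≤-reflexive count)
  where
  avoid : _ ⊆ us ++ vs
  avoid z∈xs with ∈-++⁻ us (xs⊆ys (there z∈xs))
  ... | inj₁ z∈us         = ∈-++⁺ˡ z∈us
  ... | inj₂ (here refl)  = contradiction refl (All.lookup x∉xs z∈xs)
  ... | inj₂ (there z∈vs) = ∈-++⁺ʳ us z∈vs
  count : suc (length (us ++ vs)) ≡ length (us ++ [ _ ] ++ vs)
  count = trans (cong suc (length-++ us))
                (trans (sym (+-suc (length us) (length vs))) (sym (length-++ us)))

symbols : List Symbol
symbols = bit true ∷ bit false ∷ open[ ∷ close] ∷ []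

∈-symbols : ∀ s → s ∈ symbols
∈-symbols (bit true)  = here refl
∈-symbols (bit false) = there (here refl)
∈-symbols open[       = there (there (here refl))
∈-symbols close]      = there (there (there (here refl)))

-- Sequential transducers

record Transducer : Set₁ where
  field
    State    : Set
    states   : List State
    complete : ∀ q → q ∈ states
    start    : State
    next     : State → Symbol → State
    emit     : State → Symbol → List Symbol

  -- The indices are the initial state, the input read, the output produced and the final state.
  -- Keeping both states lets runs on consecutive pieces of an encoding be glued together by
  -- `_++ʳ_`.
  data Run : State → List Symbol → List Symbol → State → Set where
    []  : ∀ {q} → Run q [] [] q
    _∷_ : ∀ {q w o r} s → Run (next q s) w o r → Run q (s ∷ w) (emit q s ++ o) r

  castʳ : ∀ {q w o o′ r} → o ≡ o′ → Run q w o r → Run q w o′ r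
  castʳ refl ρ = ρ

  infixr 5 _++ʳ_

  _++ʳ_ : ∀ {p q r u v o o′} → Run p u o q → Run q v o′ r → Run p (u ++ v) (o ++ o′) r
  []                 ++ʳ ρ′ = ρ′
  _∷_ {q = q} s ρ ++ʳ ρ′ =
    castʳ (sym (++-assoc (emit q s) _ _)) (s ∷ (ρ ++ʳ ρ′))

  concatMapʳ : ∀ {A B : Set} {q} {enc : A → List Symbol} {enc′ : B → List Symbol} {h : A → B} →
               (∀ x → Run q (enc x) (enc′ (h x)) q) →
               ∀ xs → Run q (concatMap enc xs) (concatMap enc′ (map h xs)) q
  concatMapʳ ρ []       = []
  concatMapʳ ρ (x ∷ xs) = ρ x ++ʳ concatMapʳ ρ xs

-- The Turing machine keeps pending output in its state; bounding the length of these words keeps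
-- the state set finite.
data Word≤ : ℕ → Set where
  []  : ∀ {n} → Word≤ n
  _∷_ : ∀ {n} → Symbol → Word≤ n → Word≤ (suc n)

words≤ : ∀ n → List (Word≤ n)
words≤ zero    = [ [] ]
words≤ (suc n) = [] ∷ cartesianProductWith _∷_ symbols (words≤ n)

∈-words≤ : ∀ {n} (w : Word≤ n) → w ∈ words≤ n
∈-words≤ {zero}  []      = here refl
∈-words≤ {suc n} []      = here refl
∈-words≤ {suc n} (s ∷ w) = there (∈-cartesianProductWith⁺ _∷_ (∈-symbols s) (∈-words≤ w))

toList≤ : ∀ {n} → Word≤ n → List Symbol
toList≤ []      = []
toList≤ (s ∷ w) = s ∷ toList≤ w

-- A total way into `Word≤ n`. It is applied to pending output of length at most `bound`, where by
-- `toList≤-truncate` nothing is lost.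
truncate : ∀ n → List Symbol → Word≤ n
truncate zero    _       = []
truncate (suc n) []      = []
truncate (suc n) (s ∷ w) = s ∷ truncate n w

toList≤-truncate : ∀ {n} w → length w ≤ n → toList≤ (truncate n w) ≡ w
toList≤-truncate {zero}  []      _          = refl
toList≤-truncate {suc n} []      _          = refl
toList≤-truncate {suc n} (s ∷ w) (s≤s w≤n) = cong (s ∷_) (toList≤-truncate w w≤n)

-- Simulation of a transducer by a two-tape Turing machine in linear time

module Compile (T : Transducer) where
  open Transducer T

  emitted : State × Symbol → ℕ
  emitted (q , s) = length (emit q s)

  abstract
    bound : ℕ
    bound = max 0 (map emitted (cartesianProduct states symbols))

    emit≤bound : ∀ q s → length (emit q s) ≤ bound
    emit≤bound q s = All.lookup (xs≤max 0 _)
      (∈-map⁺ emitted (∈-cartesianProduct⁺ (complete q) (∈-symbols s)))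

  -- The second component of a state is the output still to be written; the
  -- input head waits until it has been.
  transition : State → List Symbol → Vec Cell 2 → Maybe ((State × Word≤ bound) × Vec (Cell × Move) 2)
  transition q (s ∷ p) (h ∷ _ ∷ [])       =
    just ((q , truncate bound p) , (h , stay) ∷ (just s , goRight) ∷ [])
  transition q []      (just s ∷ o ∷ [])  =
    just ((next q s , truncate bound (emit q s)) , (just s , goRight) ∷ (o , stay) ∷ [])
  transition q []      (nothing ∷ _ ∷ []) = nothing

  machine : TuringMachine
  machine = record
    { State    = State × Word≤ bound
    ; states   = cartesianProduct states (words≤ bound)
    ; complete = λ (q , p) → ∈-cartesianProduct⁺ (complete q) (∈-words≤ p)
    ; start    = start , []
    ; extra    = 1
    ; δ        = λ (q , p) → transition q (toList≤ p)
    }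

  open TuringMachine machine using (Config; initial; output; halt; _⇓[_]_) renaming (next to step-then)

  ⇓-mono : ∀ {c d m n} → m ≤ n → c ⇓[ m ] d → c ⇓[ n ] d
  ⇓-mono m≤n       (halt eq)         = halt eq
  ⇓-mono (s≤s m≤n) (step-then eq c⇓) = step-then eq (⇓-mono m≤n c⇓)

  reading : List Cell → List Symbol → Tape
  reading ls []      = tape ls blank []
  reading ls (s ∷ w) = tape ls (just s) (map just w)

  written : List Cell → Tape
  written ls = tape ls blank []

  reading-goRight : ∀ ls s w → act (just s , goRight) (reading ls (s ∷ w)) ≡ reading (just s ∷ ls) w
  reading-goRight ls s []      = refl
  reading-goRight ls s (_ ∷ _) = refl

  reading-stay : ∀ ls w → act (Tape.head (reading ls w) , stay) (reading ls w) ≡ reading ls w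
  reading-stay ls []      = refl
  reading-stay ls (_ ∷ _) = refl

  contents-written : ∀ s ls → contents (written (just s ∷ ls)) ≡ contents (written ls) ++ [ s ]
  contents-written s ls
    rewrite unfold-reverse (just s) ls
          | catMaybes-++ (reverse ls ++ [ just s ]) [ nothing ]
          | catMaybes-++ (reverse ls) [ just s ]
          | catMaybes-++ (reverse ls) [ nothing ]
          | ++-identityʳ (catMaybes (reverse ls))
    = ++-identityʳ _

  config : State → List Symbol → List Cell → List Symbol → List Cell → Config
  config q p ls w ls′ = (q , truncate bound p) , reading ls w ∷ written ls′ ∷ []

  Yields : Config → ℕ → List Symbol → Set
  Yields c n o = ∃[ e ] (c ⇓[ n ] e) × (output e ≡ o)

  -- Induction on the run and, within it, on the pending output `p`. Each input symbol costs one
  -- reading step and at most `bound` writing steps, which gives the factor `suc bound`.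
  simulate : ∀ {q w o r} (p : List Symbol) ls ls′ → length p ≤ bound → Run q w o r →
             Yields (config q p ls w ls′) (length p + length w * suc bound)
                    (contents (written ls′) ++ p ++ o)
  simulate {q} {w} {o} (s ∷ p) ls ls′ p≤ ρ
    with simulate p ls (just s ∷ ls′) (≤-trans (n≤1+n _) p≤) ρ
  ... | e , c⇓e , out = e , step-then eq c⇓e , trans out written-s
    where
    eq : TuringMachine.step machine (config q (s ∷ p) ls w ls′) ≡ just (config q p ls w (just s ∷ ls′))
    eq rewrite toList≤-truncate (s ∷ p) p≤ | reading-stay ls w = refl
    written-s : contents (written (just s ∷ ls′)) ++ p ++ o ≡ contents (written ls′) ++ s ∷ p ++ o
    written-s rewrite contents-written s ls′ = ++-assoc (contents (written ls′)) [ s ] (p ++ o)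
  simulate {q} [] ls ls′ p≤ [] = _ , halt eq , sym (++-identityʳ _)
    where
    eq : TuringMachine.step machine (config q [] ls [] ls′) ≡ nothing
    eq rewrite toList≤-truncate {bound} [] z≤n = refl
  simulate {q} [] ls ls′ p≤ (_∷_ {w = w} s ρ)
    with simulate (emit q s) (just s ∷ ls) ls′ (emit≤bound q s) ρ
  ... | e , c⇓e , out =
    e , step-then eq (⇓-mono (+-monoˡ-≤ (length w * suc bound) (emit≤bound q s)) c⇓e) , out
    where
    eq : TuringMachine.step machine (config q [] ls (s ∷ w) ls′) ≡
         just (config (next q s) (emit q s) (just s ∷ ls) w ls′)
    eq rewrite toList≤-truncate {bound} [] z≤n | reading-goRight ls s w = refl

  transduces : ∀ {w o r} → Run start w o r →
               Yields (initial w) (suc bound * length w ^ 1 + suc bound) o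
  transduces {w} ρ with simulate [] [] [] z≤n ρ
  ... | e , c⇓e , out = e , subst (_⇓[ suc bound * length w ^ 1 + suc bound ] e) (initial-config w) (⇓-mono time c⇓e) , out
    where
    initial-config : ∀ w → config start [] [] w [] ≡ initial w
    initial-config w = cong₂ (λ p t → (start , p) , t ∷ blankTape ∷ []) (empty bound) (tapes w)
      where
      empty : ∀ n → truncate n [] ≡ []
      empty zero    = refl
      empty (suc n) = refl
      tapes : ∀ w → reading [] w ≡ inputTape w
      tapes []      = refl
      tapes (_ ∷ _) = refl
    time : length w * suc bound ≤ suc bound * length w ^ 1 + suc bound
    time = ≤-trans (≤-reflexive (trans (*-comm (length w) (suc bound))
                     (cong (suc bound *_) (sym (*-identityʳ (length w))))))
                   (m≤m+n _ (suc bound))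

-- The forcing relation

-- Projections and negation commute with complementation, and composition preserves this. Hence a
-- constant operation cannot belong to the clone.
Clone-self-dual : ∀ {m f} → [x̄] m f → ∀ xs → f (Vec.map not xs) ≡ not (f xs)
Clone-self-dual (gen negation) (x ∷ [])  = refl
Clone-self-dual (proj i)       xs        = Vec.lookup-map i not xs
Clone-self-dual (comp {f = f} {g = g} F Gs) xs = begin
  f (Vec.tabulate (λ i → g i (Vec.map not xs)))       ≡⟨ cong f (Vec.tabulate-cong (λ i → Clone-self-dual (Gs i) xs)) ⟩
  f (Vec.tabulate (λ i → not (g i xs)))               ≡⟨ cong f (Vec.tabulate-∘ not (λ i → g i xs)) ⟩
  f (Vec.map not (Vec.tabulate (λ i → g i xs)))       ≡⟨ Clone-self-dual F _ ⟩
  not (f (Vec.tabulate (λ i → g i xs)))               ∎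
  where open ≡-Reasoning
Clone-self-dual (ext f≗g F) xs =
  trans (sym (f≗g _)) (trans (Clone-self-dual F xs) (cong not (f≗g xs)))

map-transpose-singleton : ∀ {A B : Set} {n} (f : Vec A 1 → B) (v : Vec A n) →
                          Vec.map f (Vec.transpose (v ∷ [])) ≡ Vec.map (λ x → f (x ∷ [])) v
map-transpose-singleton f []      = refl
map-transpose-singleton f (x ∷ v) = cong (f (x ∷ []) ∷_) (map-transpose-singleton f v)

ComplementClosed : ∀ {k} → Relation k → Set
ComplementClosed R = ∀ t → R (Vec.map not t) ≡ R t

map-not-involutive : ∀ {n} (v : Vec Bool n) → Vec.map not (Vec.map not v) ≡ v
map-not-involutive v = begin
  Vec.map not (Vec.map not v)  ≡⟨ Vec.map-∘ not not v ⟨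
  Vec.map (not ∘ not) v        ≡⟨ Vec.map-cong not-involutive v ⟩
  Vec.map id v                 ≡⟨ Vec.map-id v ⟩
  v                            ∎
  where open ≡-Reasoning

not-preserves : ∀ {Γ} → Pol Γ ≐ [x̄] → ∀ {k} {R : Relation k} → Γ k R →
                ∀ t → R t ≡ true → R (Vec.map not t) ≡ true
not-preserves Pol≐ {R = R} r t Rt = subst (_∈ʳ R) (map-transpose-singleton _ t)
  (from (Pol≐ 1 _) (gen negation) _ R r (t ∷ []) (Rt VecAll.∷ VecAll.[]))

complementClosed : ∀ {Γ} → Pol Γ ≐ [x̄] → ∀ {k} {R : Relation k} → Γ k R → ComplementClosed R
complementClosed Pol≐ {R = R} r t with R t in Rt | R (Vec.map not t) in Rt̄
... | true  | true  = refl
... | false | false = refl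
... | true  | false = trans (sym Rt̄) (not-preserves Pol≐ r t Rt)
... | false | true  = trans (sym (not-preserves Pol≐ r (Vec.map not t) Rt̄))
                            (trans (cong R (map-not-involutive t)) Rt)

-- The split of the arity is a propositional equation, so the search can run over a relation of
-- arbitrary arity `k`; matching on it later removes the `subst`.
record Boundary {k} (R : Relation k) : Set where
  constructor boundary
  field
    {i j}  : ℕ
    arity  : k ≡ i + suc j
    before : Vec Bool i
    after  : Vec Bool j
    inside  : subst Relation arity R (before Vec.++ true ∷ after) ≡ true
    outside : subst Relation arity R (before Vec.++ false ∷ after) ≡ false

-- Lowering the ones of a tuple of R one by one must leave R at some point.
findBoundary : ∀ {k} (R : Relation k) t → R t ≡ true → R (Vec.replicate k false) ≡ false → Boundary R
findBoundary R []          Rt R0 = contradiction (trans (sym Rt) R0) λ ()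
findBoundary R (x ∷ t)     Rt R0 with R (false ∷ t) in Rft
findBoundary R (x ∷ t)     Rt R0 | true with findBoundary (R ∘ (false ∷_)) t Rft R0
... | boundary refl before after inside outside = boundary refl (false ∷ before) after inside outside
findBoundary R (true ∷ t)  Rt R0 | false = boundary refl [] t Rt Rft
findBoundary R (false ∷ t) Rt R0 | false = contradiction (trans (sym Rt) Rft) λ ()

-- With the other coordinates set to `before` and `after`, the relation pins the remaining one to 1.
-- By `complement` the complemented pattern pins it to 0, and `nonzero` rules out that both constant
-- variables are equal.
record Forcing (Γ : Language) : Set where
  field
    {i j}      : ℕ
    R          : Relation (i + suc j)
    R∈Γ        : Γ (i + suc j) R
    before     : Vec Bool i
    after      : Vec Bool j
    inside     : R (before Vec.++ true ∷ after) ≡ true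
    outside    : R (before Vec.++ false ∷ after) ≡ false
    complement : ComplementClosed R
    nonzero    : R (Vec.replicate _ false) ≡ false

-- Excluded middle settles whether the possibly infinite `Γ` has a nonempty relation without the
-- all-zeros tuple. If it has, lowering ones in a tuple of that relation reaches a boundary.
findForcing : ExcludedMiddle 0ℓ → ∀ {Γ} → Pol Γ ≐ [x̄] → Forcing Γ
findForcing em {Γ} Pol≐
  with em {∃[ k ] Σ[ R ∈ Relation k ] Γ k R × ∃[ t ] (R t ≡ true) × R (Vec.replicate k false) ≡ false}
... | yes (k , R , r , t , Rt , R0) = fromBoundary (findBoundary R t Rt R0)
  where
  fromBoundary : Boundary R → Forcing Γ
  fromBoundary (boundary refl before after inside outside) = record
    { R = R ; R∈Γ = r ; before = before ; after = after ; inside = inside ; outside = outside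
    ; complement = complementClosed Pol≐ r ; nonzero = R0 }
-- Every nonempty relation would then contain the all-zeros tuple, making the constant 0 a
-- polymorphism; but this operation is not self-dual.
... | no none = contradiction (Clone-self-dual (to (Pol≐ 1 _) zero-polymorphism) (false ∷ [])) λ ()
  where
  zero-polymorphism : Pol Γ 1 (const false)
  zero-polymorphism k R r (t ∷ []) (Rt VecAll.∷ VecAll.[])
    rewrite map-transpose-singleton (const false) t | Vec.map-const t false
    = ¬-not λ R0 → none (k , R , r , t , Rt , R0)

-- Fresh variables for the constants and the constraints that force a value

constant : Bool → Var
constant true  = [ true ]
constant false = []

-- A word with leading `false` is neither `[]` nor `[ true ]`, so renamed variables never clash with
-- the two constant variables.
prime : Var → Var
prime = false ∷_

orient : ∀ {n} → Bool → Vec Bool n → Vec Bool n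
orient true  = id
orient false = Vec.map not

Standard : Assignment → Set
Standard σ = σ ∘ constant ≗ id

standard-map : ∀ {σ n} → Standard σ → (v : Vec Bool n) → Vec.map σ (Vec.map constant v) ≡ v
standard-map {σ} std v = begin
  Vec.map σ (Vec.map constant v)  ≡⟨ Vec.map-∘ σ constant v ⟨
  Vec.map (σ ∘ constant) v        ≡⟨ Vec.map-cong std v ⟩
  Vec.map id v                    ≡⟨ Vec.map-id v ⟩
  v                               ∎
  where open ≡-Reasoning

module Force {Γ : Language} (F : Forcing Γ) where
  open Forcing F

  tuplesOf : List (Vec Bool (i + suc j))
  tuplesOf = filter (λ t → R t ≟ᵇ true) (vectors bools _)

  force : Bool → Var → Constraint Γ
  force b x = record
    { relation = R
    ; inΓ      = R∈Γ
    ; tuples   = tuplesOf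
    ; listing  = λ t → mk⇔ (λ t∈ → proj₂ (∈-filter⁻ (λ t → R t ≟ᵇ true) {xs = vectors bools _} t∈))
                           (∈-filter⁺ (λ t → R t ≟ᵇ true) (∈-vectors ∈-bools t))
    ; scope    = Vec.map constant (orient b before) Vec.++ x ∷ Vec.map constant (orient b after)
    }

  -- For `b = true` these are the two sides of the boundary. For `b = false` complement closure
  -- carries both sides over to the complemented pattern.
  orient-R : ∀ b c → R (orient b before Vec.++ c ∷ orient b after) ≡ true ⇔ c ≡ b
  orient-R true  true  = mk⇔ (λ _ → refl) (λ _ → inside)
  orient-R true  false = mk⇔ (λ p → trans (sym outside) p) (λ ())
  orient-R false c     = mk⇔ (cases c) λ { refl → trans (flipped true) inside }
    where
    flipped : ∀ c → R (Vec.map not before Vec.++ not c ∷ Vec.map not after) ≡ R (before Vec.++ c ∷ after)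
    flipped c = trans (cong R (sym (Vec.map-++ not before (c ∷ after)))) (complement _)
    cases : ∀ c → R (Vec.map not before Vec.++ c ∷ Vec.map not after) ≡ true → c ≡ false
    cases false _ = refl
    cases true  p = trans (sym p) (trans (flipped false) outside)

  force-⇔ : ∀ {σ} → Standard σ → ∀ b x → σ ⊨ᶜ force b x ⇔ σ x ≡ b
  force-⇔ {σ} std b x = subst (λ t → R t ≡ true ⇔ σ x ≡ b) (sym scope-value) (orient-R b (σ x))
    where
    scope-value : Vec.map σ (Constraint.scope (force b x)) ≡ orient b before Vec.++ σ x ∷ orient b after
    scope-value = trans (Vec.map-++ σ (Vec.map constant (orient b before)) _)
      (cong₂ (λ u v → u Vec.++ σ x ∷ v) (standard-map {σ} std (orient b before)) (standard-map {σ} std (orient b after)))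

  -- If both constants were true, the scope would be the all-ones tuple.
  force-standard : ∀ {σ} → σ ⊨ᶜ force true (constant true) → σ (constant true) ≡ true → Standard σ
  force-standard {σ} sat t true = t
  force-standard {σ} sat t false = ¬-not λ f → contradiction (trans (sym sat) (ones f)) λ ()
    where
    u : Vec Bool (i + suc j)
    u = before Vec.++ true ∷ after
    ones : σ (constant false) ≡ true → R (Vec.map σ (Constraint.scope (force true (constant true)))) ≡ false
    ones f = begin
      R (Vec.map σ (Constraint.scope (force true (constant true))))
        ≡⟨ cong (R ∘ Vec.map σ) (Vec.map-++ constant before (true ∷ after)) ⟨
      R (Vec.map σ (Vec.map constant u))   ≡⟨ cong R (Vec.map-∘ σ constant u) ⟨
      R (Vec.map (σ ∘ constant) u)         ≡⟨ cong R (Vec.map-cong (λ { true → t ; false → f }) u) ⟩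
      R (Vec.map (const true) u)           ≡⟨ cong R (Vec.map-const u true) ⟩
      R (Vec.replicate _ true)             ≡⟨ cong R (Vec.map-replicate not false (i + suc j)) ⟨
      R (Vec.map not (Vec.replicate _ false)) ≡⟨ complement _ ⟩
      R (Vec.replicate _ false)            ≡⟨ nonzero ⟩
      false                                ∎
      where open ≡-Reasoning

-- Translating constraints

-- The kinds of variable lists in an encoding: a copied scope, the hypotheses, the manifestations,
-- and the one-word scope of a constraint being replaced. They share one copying loop and differ
-- only in what surrounds the renamed words.
data Context : Set where
  inScope inH inM : Context
  inForce         : Bool → Context

-- In the `same` states with index b, all tuples of the current constraint read
-- so far are the unary tuple (b), and no output has been produced for it yet.
-- The subscript ₁ means that one bit of the current tuple has been read.
data Position : Set where
  kbStart kb tuplesStart tuples₀ firstTuple inTuple inTuples constraintEnd done : Position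
  firstTuple₁ same sameTuple sameTuple₁ : Bool → Position
  enter inList inWord                   : Context → Position

contexts : List Context
contexts = inScope ∷ inH ∷ inM ∷ map inForce bools

∈-contexts : ∀ c → c ∈ contexts
∈-contexts inScope     = here refl
∈-contexts inH         = there (here refl)
∈-contexts inM         = there (there (here refl))
∈-contexts (inForce b) = there (there (there (∈-map⁺ inForce (∈-bools b))))

positions : List Position
positions =
  (kbStart ∷ kb ∷ tuplesStart ∷ tuples₀ ∷ firstTuple ∷ inTuple ∷ inTuples ∷ constraintEnd ∷ done ∷ []) ++
  -- Combining by application lists each constructor at each of its arguments.
  cartesianProductWith (λ f → f) (firstTuple₁ ∷ same ∷ sameTuple ∷ sameTuple₁ ∷ []) bools ++
  cartesianProductWith (λ f → f) (enter ∷ inList ∷ inWord ∷ []) contexts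

∈-positions : ∀ q → q ∈ positions
∈-positions = λ where
    kbStart         → here refl
    kb              → there (here refl)
    tuplesStart     → there (there (here refl))
    tuples₀         → there (there (there (here refl)))
    firstTuple      → there (there (there (there (here refl))))
    inTuple         → there (there (there (there (there (here refl)))))
    inTuples        → there (there (there (there (there (there (here refl))))))
    constraintEnd   → there (there (there (there (there (there (there (here refl)))))))
    done            → there (there (there (there (there (there (there (there (here refl))))))))
    (firstTuple₁ b) → withBool b (here refl)
    (same b)        → withBool b (there (here refl))
    (sameTuple b)   → withBool b (there (there (here refl)))
    (sameTuple₁ b)  → withBool b (there (there (there (here refl))))
    (enter c)       → withContext c (here refl)
    (inList c)      → withContext c (there (here refl))
    (inWord c)      → withContext c (there (there (here refl)))
  where
  withBool : ∀ b {f} → f ∈ firstTuple₁ ∷ same ∷ sameTuple ∷ sameTuple₁ ∷ [] → f b ∈ positions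
  -- There are 9 positions without an argument, followed by 4 times 2 indexed by a bit; hence the
  -- offsets 9 here and 17 below.
  withBool b f∈ = ∈-++⁺ʳ (List.take 9 positions) (∈-++⁺ˡ (∈-cartesianProductWith⁺ (λ f → f) f∈ (∈-bools b)))
  withContext : ∀ c {f} → f ∈ enter ∷ inList ∷ inWord ∷ [] → f c ∈ positions
  withContext c f∈ = ∈-++⁺ʳ (List.take 17 positions) (∈-cartesianProductWith⁺ (λ f → f) f∈ (∈-contexts c))

encodeTuple : ∀ {k} → Vec Bool k → List Symbol
encodeTuple = encodeWord ∘ Vec.toList

compress : Bool → List (Vec Bool 1) → List (Vec Bool 1)
compress b []              = [ b ∷ [] ]
compress b ((c ∷ []) ∷ ts) =
  if does (b ≟ᵇ c) then compress b ts else (b ∷ []) ∷ (c ∷ []) ∷ ts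

-- While reading a list of unary tuples that agree so far, a one-way machine
-- cannot know whether to copy them or to replace the constraint. It need not
-- count them, because a listing may drop repetitions.
normalise : ∀ {k} → List (Vec Bool k) → List (Vec Bool k)
normalise {suc zero} ((b ∷ []) ∷ ts) = compress b ts
normalise            ts              = ts

∈-compress : ∀ {t} b ts → t ∈ compress b ts ⇔ t ∈ (b ∷ []) ∷ ts
∈-compress b     []                  = mk⇔ id id
∈-compress true  ((false ∷ []) ∷ ts) = mk⇔ id id
∈-compress false ((true ∷ []) ∷ ts)  = mk⇔ id id
∈-compress true  ((true ∷ []) ∷ ts)  = mk⇔
  (there ∘ to (∈-compress true ts))
  λ { (here refl) → from (∈-compress true ts) (here refl) ; (there t∈) → from (∈-compress true ts) t∈ }
∈-compress false ((false ∷ []) ∷ ts) = mk⇔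
  (there ∘ to (∈-compress false ts))
  λ { (here refl) → from (∈-compress false ts) (here refl) ; (there t∈) → from (∈-compress false ts) t∈ }

∈-normalise : ∀ {k} {t : Vec Bool k} ts → t ∈ normalise ts ⇔ t ∈ ts
∈-normalise {zero}        ts              = mk⇔ id id
∈-normalise {suc zero}    []              = mk⇔ id id
∈-normalise {suc zero}    ((b ∷ []) ∷ ts) = ∈-compress b ts
∈-normalise {suc (suc _)} ts              = mk⇔ id id

Listing : ∀ {k} → List (Vec Bool k) → Relation k → Set
Listing ts R = ∀ t → t ∈ ts ⇔ t ∈ʳ R

⇔-trans : ∀ {A B C : Set} → A ⇔ B → B ⇔ C → A ⇔ C
⇔-trans p q = mk⇔ (to q ∘ to p) (from p ∘ from q)

UnarySingleton : Bool → Relation 1 → Set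
UnarySingleton b R = ∀ c → R (c ∷ []) ≡ true ⇔ c ≡ b

⊥-singleton : ∀ {R} → R ≗ ⊥ʳ → UnarySingleton false R
⊥-singleton R≗ true  = mk⇔ (λ p → trans (sym p) (R≗ _)) (λ ())
⊥-singleton R≗ false = mk⇔ (λ _ → refl) (λ _ → R≗ _)

⊤-singleton : ∀ {R} → R ≗ ⊤ʳ → UnarySingleton true R
⊤-singleton R≗ true  = mk⇔ (λ _ → refl) (λ _ → R≗ _)
⊤-singleton R≗ false = mk⇔ (λ p → trans (sym (R≗ _)) p) (λ ())

module Translate {Γ : Language} (closed : ∀ {k} {R : Relation k} → Γ k R → ComplementClosed R)
                 (F : Forcing Γ) where
  open Forcing F using (before; after)
  open Force F

  -- The case split is on the membership proof, whereas the transducer sees only the tuples. The two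
  -- agree because a complement-closed relation is never a unary singleton.
  translateAs : ∀ {k} {R : Relation k} → (Γ ∪⊥⊤) k R → (ts : List (Vec Bool k)) → Listing ts R →
                Vec Var k → Constraint Γ
  translateAs (old r) ts l xs = record
    { inΓ     = r
    ; tuples  = normalise ts
    ; listing = λ t → ⇔-trans (∈-normalise ts) (l t)
    ; scope   = Vec.map prime xs
    }
  translateAs (bot _) _ _ (x ∷ []) = force false (prime x)
  translateAs (top _) _ _ (x ∷ []) = force true (prime x)

  translate : Constraint (Γ ∪⊥⊤) → Constraint Γ
  translate C = translateAs inΓ tuples listing scope
    where open Constraint C

  reduce : Instance (Γ ∪⊥⊤) → Instance Γ
  reduce I = record
    { KB = force true (constant true) ∷ map translate KB
    ; H  = constant true ∷ map prime H
    ; M  = constant true ∷ map prime M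
    }
    where open Instance I

  constants : ∀ {n} → Vec Bool n → List Symbol
  constants v = concatMap encodeWord (Vec.toList (Vec.map constant v))

  -- For `inH` and `inM` the variable t is inserted in front. For `inForce` the opening also
  -- supplies the bracket of the constraint, withheld so far, and the whole tuple list; the single
  -- scope word then falls between the two blocks of constants.
  opening closing : Context → List Symbol
  opening inScope     = [ open[ ]
  opening inH         = open[ ∷ encodeWord (constant true)
  opening inM         = open[ ∷ encodeWord (constant true)
  opening (inForce b) = open[ ∷ encodeList encodeTuple tuplesOf ++ open[ ∷ constants (orient b before)
  closing inScope     = [ close] ]
  closing inH         = [ close] ]
  closing inM         = [ close] ]
  closing (inForce b) = constants (orient b after) ++ [ close] ]

  leave : Context → Position
  leave inScope     = constraintEnd
  leave inH         = enter inM
  leave inM         = done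
  leave (inForce _) = constraintEnd

  transition : Position → Symbol → Position × List Symbol
  transition kbStart         open[   = kb , open[ ∷ encodeConstraint (force true (constant true))
  -- The bracket is withheld until the tuples show whether the constraint is copied or replaced.
  transition kb              open[   = tuplesStart , []
  transition kb              close]  = enter inH , [ close] ]
  transition tuplesStart     open[   = tuples₀ , []
  transition tuples₀         open[   = firstTuple , []
  transition tuples₀         close]  = enter inScope , open[ ∷ open[ ∷ close] ∷ []
  transition firstTuple      (bit b) = firstTuple₁ b , []
  transition firstTuple      close]  = inTuples , open[ ∷ open[ ∷ open[ ∷ close] ∷ []
  transition (firstTuple₁ b) (bit c) = inTuple , open[ ∷ open[ ∷ open[ ∷ bit b ∷ bit c ∷ []
  transition (firstTuple₁ b) close]  = same b , []
  transition (same b)        open[   = sameTuple b , []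
  transition (same b)        close]  = enter (inForce b) , []
  -- A differing bit settles that the constraint is copied: the withheld brackets are written, with
  -- one copy of the tuple (b) standing for all those read.
  transition (sameTuple b)   (bit c) =
    if does (b ≟ᵇ c) then (sameTuple₁ b , [])
    else (inTuple , open[ ∷ open[ ∷ open[ ∷ bit b ∷ close] ∷ open[ ∷ bit c ∷ [])
  transition (sameTuple₁ b)  close]  = same b , []
  transition inTuple         (bit b) = inTuple , [ bit b ]
  transition inTuple         close]  = inTuples , [ close] ]
  transition inTuples        open[   = inTuple , [ open[ ]
  transition inTuples        close]  = enter inScope , [ close] ]
  transition (enter c)       open[   = inList c , opening c
  transition (inList c)      open[   = inWord c , open[ ∷ bit false ∷ []
  transition (inList c)      close]  = leave c , closing c
  transition (inWord c)      (bit b) = inWord c , [ bit b ]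
  transition (inWord c)      close]  = inList c , [ close] ]
  transition constraintEnd   close]  = kb , [ close] ]
  -- Malformed input ends here; the runs on encoded instances constructed below do not pass through
  -- this clause.
  transition _               _       = done , []

  transducer : Transducer
  transducer = record
    { State    = Position
    ; states   = positions
    ; complete = ∈-positions
    ; start    = kbStart
    ; next     = λ q s → proj₁ (transition q s)
    ; emit     = λ q s → proj₂ (transition q s)
    }

  open Transducer transducer

  -- Runs of the transducer on encoded instances

  inWordʳ : ∀ c w → Run (inWord c) (map bit w ++ [ close] ]) (map bit w ++ [ close] ]) (inList c)
  inWordʳ c []      = close] ∷ []
  inWordʳ c (b ∷ w) = bit b ∷ inWordʳ c w

  listʳ : ∀ c ws → Run (enter c) (encodeList encodeWord ws)
            (opening c ++ concatMap encodeWord (map prime ws) ++ closing c) (leave c)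
  listʳ c ws = open[ ∷ (concatMapʳ (λ w → open[ ∷ inWordʳ c w) ws ++ʳ
    castʳ (++-identityʳ (closing c)) (close] ∷ []))

  tupleʳ : ∀ w → Run inTuple (map bit w ++ [ close] ]) (map bit w ++ [ close] ]) inTuples
  tupleʳ []      = close] ∷ []
  tupleʳ (b ∷ w) = bit b ∷ tupleʳ w

  tuplesʳ : ∀ {k} (ts : List (Vec Bool k)) →
            Run inTuples (concatMap encodeTuple ts ++ [ close] ]) (concatMap encodeTuple ts ++ [ close] ]) (enter inScope)
  tuplesʳ ts = copy ts ++ʳ (close] ∷ [])
    where
    copy : ∀ ts → Run inTuples (concatMap encodeTuple ts) (concatMap encodeTuple ts) inTuples
    copy []       = []
    copy (t ∷ ts) = (open[ ∷ tupleʳ (Vec.toList t)) ++ʳ copy ts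

  -- The complementary tuple is still to come, so the scan of equal tuples is bound to be
  -- interrupted. The extra leading bracket of the output is the withheld one of the constraint.
  mixedʳ : ∀ b ts → not b ∷ [] ∈ ts →
           Run (same b) (concatMap encodeTuple ts ++ [ close] ])
               (open[ ∷ encodeList encodeTuple (compress b ts)) (enter inScope)
  mixedʳ true  ((false ∷ []) ∷ ts) _          = open[ ∷ bit false ∷ close] ∷ tuplesʳ ts
  mixedʳ false ((true ∷ []) ∷ ts)  _          = open[ ∷ bit true ∷ close] ∷ tuplesʳ ts
  mixedʳ true  ((true ∷ []) ∷ ts)  (there ∈ts) = open[ ∷ bit true ∷ close] ∷ mixedʳ true ts ∈ts
  mixedʳ false ((false ∷ []) ∷ ts) (there ∈ts) = open[ ∷ bit false ∷ close] ∷ mixedʳ false ts ∈ts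

  constantʳ : ∀ b ts → (∀ c → (c ∷ []) ∈ ts → c ≡ b) →
              Run (same b) (concatMap encodeTuple ts ++ [ close] ]) [] (enter (inForce b))
  constantʳ b     []              all = close] ∷ []
  constantʳ b     ((c ∷ []) ∷ ts) all with all c (here refl)
  constantʳ true  ((_ ∷ []) ∷ ts) all | refl =
    open[ ∷ bit true ∷ close] ∷ constantʳ true ts (λ c → all c ∘ there)
  constantʳ false ((_ ∷ []) ∷ ts) all | refl =
    open[ ∷ bit false ∷ close] ∷ constantʳ false ts (λ c → all c ∘ there)

  -- Γ-relations are closed under complement, so no unary one is a singleton.
  oldTuplesʳ : ∀ {k} {R : Relation k} → Γ k R → ∀ ts → Listing ts R →
               Run tuplesStart (encodeList encodeTuple ts)
                   (open[ ∷ encodeList encodeTuple (normalise ts)) (enter inScope)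
  oldTuplesʳ {zero}        r []              l = open[ ∷ close] ∷ []
  oldTuplesʳ {suc zero}    r []              l = open[ ∷ close] ∷ []
  oldTuplesʳ {suc (suc _)} r []              l = open[ ∷ close] ∷ []
  oldTuplesʳ {zero}        r ([] ∷ ts)       l = open[ ∷ open[ ∷ close] ∷ tuplesʳ ts
  oldTuplesʳ {suc (suc _)} r ((b ∷ c ∷ t) ∷ ts) l =
    open[ ∷ open[ ∷ bit b ∷ bit c ∷
      subst (λ w → Run inTuple w w _) (sym (++-assoc (map bit (Vec.toList t) ++ [ close] ]) _ _))
        (tupleʳ (Vec.toList t) ++ʳ tuplesʳ ts)
  oldTuplesʳ {suc zero}    r ((b ∷ []) ∷ ts) l =
    open[ ∷ open[ ∷ bit b ∷ close] ∷ mixedʳ b ts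
      (other b (from (l (not b ∷ [])) (trans (closed r (b ∷ [])) (to (l (b ∷ [])) (here refl)))))
    where
    other : ∀ b → (not b ∷ []) ∈ (b ∷ []) ∷ ts → (not b ∷ []) ∈ ts
    other true  (there ∈ts) = ∈ts
    other false (there ∈ts) = ∈ts

  singletonTuplesʳ : ∀ {b} {R : Relation 1} → UnarySingleton b R → ∀ ts → Listing ts R →
                     Run tuplesStart (encodeList encodeTuple ts) [] (enter (inForce b))
  singletonTuplesʳ {b} R= [] l with from (l (b ∷ [])) (from (R= b) refl)
  ... | ()
  singletonTuplesʳ {b} R= ((c ∷ []) ∷ ts) l with to (R= c) (to (l (c ∷ [])) (here refl))
  ... | refl = open[ ∷ open[ ∷ bit b ∷ close] ∷
    constantʳ b ts (λ c c∈ → to (R= c) (to (l (c ∷ [])) (there c∈)))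

  -- The outputs before, at and after the single scope word reassociate to the encoding of the
  -- replacement constraint.
  force-encode : ∀ b x → (opening (inForce b) ++ concatMap encodeWord [ x ] ++ closing (inForce b)) ++ [ close] ]
                         ≡ encodeConstraint (force b x)
  force-encode b x = cong (λ o → open[ ∷ o ++ [ close] ]) (begin
    (T ++ open[ ∷ P) ++ X ++ S ++ [ close] ]      ≡⟨ ++-assoc T (open[ ∷ P) _ ⟩
    T ++ open[ ∷ P ++ X ++ S ++ [ close] ]        ≡⟨ cong (λ o → T ++ open[ ∷ o) scope-encode ⟩
    T ++ encodeList encodeWord (Vec.toList (Constraint.scope (force b x))) ∎)
    where
    open ≡-Reasoning
    T P X S : List Symbol
    T = encodeList encodeTuple tuplesOf
    P = constants (orient b before)
    X = concatMap encodeWord [ x ]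
    S = constants (orient b after)
    ps = Vec.map constant (orient b before)
    ss = Vec.map constant (orient b after)
    scope-encode : P ++ X ++ S ++ [ close] ] ≡
                   concatMap encodeWord (Vec.toList (ps Vec.++ x ∷ ss)) ++ [ close] ]
    scope-encode = begin
      P ++ X ++ S ++ [ close] ]        ≡⟨ cong (P ++_) (++-assoc X S _) ⟨
      P ++ (X ++ S) ++ [ close] ]      ≡⟨ ++-assoc P (X ++ S) _ ⟨
      (P ++ X ++ S) ++ [ close] ]      ≡⟨ cong (λ o → (P ++ o) ++ [ close] ]) (concatMap-++ encodeWord [ x ] (Vec.toList ss)) ⟨
      (P ++ concatMap encodeWord (x ∷ Vec.toList ss)) ++ [ close] ]
        ≡⟨ cong (_++ [ close] ]) (concatMap-++ encodeWord (Vec.toList ps) (x ∷ Vec.toList ss)) ⟨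
      concatMap encodeWord (Vec.toList ps ++ x ∷ Vec.toList ss) ++ [ close] ]
        ≡⟨ cong (λ ws → concatMap encodeWord ws ++ [ close] ]) (Vec.toList-++ ps (x ∷ ss)) ⟨
      concatMap encodeWord (Vec.toList (ps Vec.++ x ∷ ss)) ++ [ close] ] ∎

  singletonʳ : ∀ {b} {R : Relation 1} → UnarySingleton b R → ∀ ts → Listing ts R → ∀ x →
               Run kb (bracket (encodeList encodeTuple ts ++ encodeList encodeWord [ x ]))
                   (encodeConstraint (force b (prime x))) kb
  singletonʳ {b} R= ts l x = castʳ (force-encode b (prime x))
    (open[ ∷ ((singletonTuplesʳ R= ts l ++ʳ listʳ (inForce b) [ x ]) ++ʳ (close] ∷ [])))

  translateʳ : ∀ {k} {R : Relation k} (p : (Γ ∪⊥⊤) k R) ts l xs →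
               Run kb (bracket (encodeList encodeTuple ts ++ encodeList encodeWord (Vec.toList xs)))
                   (encodeConstraint (translateAs p ts l xs)) kb
  translateʳ (old r) ts l xs rewrite Vec.toList-map prime xs =
    open[ ∷ ((oldTuplesʳ r ts l ++ʳ listʳ inScope (Vec.toList xs)) ++ʳ (close] ∷ []))
  translateʳ (bot R≗) ts l (x ∷ []) = singletonʳ (⊥-singleton R≗) ts l x
  translateʳ (top R≗) ts l (x ∷ []) = singletonʳ (⊤-singleton R≗) ts l x

  kbʳ : ∀ φ → Run kbStart (encodeList encodeConstraint φ)
                  (encodeList encodeConstraint (force true (constant true) ∷ map translate φ)) (enter inH)
  kbʳ φ = castʳ
    (cong (open[ ∷_) (sym (++-assoc (encodeConstraint (force true (constant true))) _ [ close] ])))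
    (open[ ∷ (concatMapʳ (λ C → let open Constraint C in translateʳ inΓ tuples listing scope) φ ++ʳ (close] ∷ [])))

  reduceʳ : ∀ I → Run kbStart (encodeInstance I) (encodeInstance (reduce I)) done
  reduceʳ I = kbʳ KB ++ʳ listʳ inH H ++ʳ listʳ inM M
    where open Instance I

  -- Correctness of the translation

  reflect : Assignment → Assignment
  reflect τ = τ ∘ prime

  -- Among words with leading `true`, only t occurs in a reduced instance. `reflect (extend σ)` is
  -- definitionally `σ`, so models transfer back without rewriting.
  extend : Assignment → Assignment
  extend σ []          = false
  extend σ (true ∷ _)  = true
  extend σ (false ∷ x) = σ x

  extend-standard : ∀ σ → Standard (extend σ)
  extend-standard σ true  = refl
  extend-standard σ false = refl

  singleton-⇔ : ∀ {τ b} {R : Relation 1} → UnarySingleton b R → Standard τ → ∀ x →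
                τ ⊨ᶜ force b (prime x) ⇔ R (reflect τ x ∷ []) ≡ true
  singleton-⇔ {τ} {b} R= std x = mk⇔
    (from (R= _) ∘ to (force-⇔ {τ} std b (prime x)))
    (from (force-⇔ {τ} std b (prime x)) ∘ to (R= _))

  translateAs-⇔ : ∀ {τ k} {R : Relation k} → Standard τ → (p : (Γ ∪⊥⊤) k R) → ∀ ts l xs →
                  τ ⊨ᶜ translateAs p ts l xs ⇔ Vec.map (reflect τ) xs ∈ʳ R
  translateAs-⇔ {τ} {R = R} std (old r) ts l xs =
    subst (λ t → t ∈ʳ R ⇔ Vec.map (reflect τ) xs ∈ʳ R) (Vec.map-∘ τ prime xs) (mk⇔ id id)
  translateAs-⇔ {τ} {R = R} std (bot R≗) ts l (x ∷ []) = singleton-⇔ {τ} {R = R} (⊥-singleton R≗) std x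
  translateAs-⇔ {τ} {R = R} std (top R≗) ts l (x ∷ []) = singleton-⇔ {τ} {R = R} (⊤-singleton R≗) std x

  translate-⇔ : ∀ {τ} → Standard τ → ∀ C → τ ⊨ᶜ translate C ⇔ reflect τ ⊨ᶜ C
  translate-⇔ {τ} std C = translateAs-⇔ {τ} std inΓ tuples listing scope
    where open Constraint C

  reflect-⊨ : ∀ {τ φ} → Standard τ → τ ⊨ map translate φ → reflect τ ⊨ φ
  reflect-⊨ {τ} std sat = All.map (λ {C} → to (translate-⇔ {τ} std C)) (All.map⁻ sat)

  extend-⊨ : ∀ {σ φ} → σ ⊨ φ → extend σ ⊨ force true (constant true) ∷ map translate φ
  extend-⊨ {σ} sat =
    from (force-⇔ {extend σ} (extend-standard σ) true (constant true)) refl ∷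
    All.map⁺ (All.map (λ {C} → from (translate-⇔ {extend σ} (extend-standard σ) C)) sat)

primeˡ : Literal → Literal
primeˡ (pos x) = pos (prime x)
primeˡ (neg x) = neg (prime x)

primeˡ-⇔ : ∀ {τ} ℓ → τ ⊨ˡ primeˡ ℓ ⇔ (τ ∘ prime) ⊨ˡ ℓ
primeˡ-⇔ (pos x) = mk⇔ id id
primeˡ-⇔ (neg x) = mk⇔ id id

-- Abstracts which literals over the hypotheses may be used, so that one proof serves both abduction
-- problems. By `prime⁻` the only new literals of a reduced instance are those on the added
-- variable.
record LiteralClass : Set where
  field
    literals : List Var → List Literal
    pos∈     : ∀ {x H} → x ∈ H → pos x ∈ literals H
    prime⁺   : ∀ {x H ℓ} → ℓ ∈ literals H → primeˡ ℓ ∈ literals (x ∷ map prime H)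
    prime⁻   : ∀ {x H ℓ} → ℓ ∈ literals (x ∷ map prime H) →
               (ℓ ≡ pos x ⊎ ℓ ≡ neg x) ⊎ ∃[ ℓ₀ ] ℓ₀ ∈ literals H × ℓ ≡ primeˡ ℓ₀

positiveLiterals : LiteralClass
positiveLiterals = record
  { literals = map pos
  ; pos∈     = ∈-map⁺ pos
  ; prime⁺   = prime⁺
  ; prime⁻   = prime⁻
  }
  where
  prime⁺ : ∀ {x H ℓ} → ℓ ∈ map pos H → primeˡ ℓ ∈ map pos (x ∷ map prime H)
  prime⁺ ℓ∈ with y , y∈ , refl ← ∈-map⁻ pos ℓ∈ = there (∈-map⁺ pos (∈-map⁺ prime y∈))
  prime⁻ : ∀ {x H ℓ} → ℓ ∈ map pos (x ∷ map prime H) →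
           (ℓ ≡ pos x ⊎ ℓ ≡ neg x) ⊎ ∃[ ℓ₀ ] ℓ₀ ∈ map pos H × ℓ ≡ primeˡ ℓ₀
  prime⁻ (here refl) = inj₁ (inj₁ refl)
  prime⁻ (there ℓ∈) with y , y∈ , refl ← ∈-map⁻ pos ℓ∈ with z , z∈ , refl ← ∈-map⁻ prime y∈ =
    inj₂ (pos z , ∈-map⁺ pos z∈ , refl)

allLiterals : LiteralClass
allLiterals = record
  { literals = lits
  ; pos∈     = ∈-++⁺ˡ ∘ ∈-map⁺ pos
  ; prime⁺   = prime⁺
  ; prime⁻   = prime⁻
  }
  where
  lits : List Var → List Literal
  lits H = map pos H ++ map neg H
  prime⁺ : ∀ {x H ℓ} → ℓ ∈ lits H → primeˡ ℓ ∈ lits (x ∷ map prime H)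
  prime⁺ {H = H} ℓ∈ with ∈-++⁻ (map pos H) ℓ∈
  ... | inj₁ ℓ∈⁺ = ∈-++⁺ˡ (LiteralClass.prime⁺ positiveLiterals ℓ∈⁺)
  ... | inj₂ ℓ∈⁻ with y , y∈ , refl ← ∈-map⁻ neg ℓ∈⁻ =
    ∈-++⁺ʳ (map pos (_ ∷ map prime H)) (there (∈-map⁺ neg (∈-map⁺ prime y∈)))
  prime⁻ : ∀ {x H ℓ} → ℓ ∈ lits (x ∷ map prime H) →
           (ℓ ≡ pos x ⊎ ℓ ≡ neg x) ⊎ ∃[ ℓ₀ ] ℓ₀ ∈ lits H × ℓ ≡ primeˡ ℓ₀
  prime⁻ {x} {H} ℓ∈ with ∈-++⁻ (map pos (x ∷ map prime H)) ℓ∈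
  ... | inj₂ (here refl) = inj₁ (inj₂ refl)
  ... | inj₂ (there ℓ∈⁻) with y , y∈ , refl ← ∈-map⁻ neg ℓ∈⁻ with z , z∈ , refl ← ∈-map⁻ prime y∈ =
    inj₂ (neg z , ∈-++⁺ʳ (map pos H) (∈-map⁺ neg z∈) , refl)
  ... | inj₁ ℓ∈⁺ with LiteralClass.prime⁻ positiveLiterals ℓ∈⁺
  ...   | inj₁ ℓ≡              = inj₁ ℓ≡
  ...   | inj₂ (ℓ₀ , ℓ₀∈ , ℓ≡) = inj₂ (ℓ₀ , ∈-++⁺ˡ ℓ₀∈ , ℓ≡)

-- At `allLiterals` and `positiveLiterals` this unfolds to `ABD Γ` and `P-ABD Γ`.
abduction : LiteralClass → Language → Problem
abduction L Γ = record
  { Inst   = Instance Γ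
  ; encode = encodeInstance
  ; vars   = #var
  ; Yes    = λ I → ∃[ E ] (E ⊆ LiteralClass.literals L (Instance.H I)) × Explanation I E
  }

-- Eliminating the constant relations

module AddConstants (em : ExcludedMiddle 0ℓ) (L : LiteralClass) {Γ : Language}
                    (closed : ∀ {k} {R : Relation k} → Γ k R → ComplementClosed R)
                    (F : Forcing Γ) where
  open LiteralClass L
  open Forcing F using (before; after)
  open Force F
  open Translate closed F

  A = abduction L (Γ ∪⊥⊤)
  B = abduction L Γ

  t : Var
  t = constant true

  -- The literal t joins the renamed explanation. Together with the first constraint it makes every
  -- model standard, so its reflection is a model of the original instance.
  sound : ∀ I → Problem.Yes A I → Problem.Yes B (reduce I)
  sound I (E , E⊆ , (σ , σ⊨KB , σ⊨E) , entails) =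
    pos t ∷ map primeˡ E , E′⊆ ,
    (extend σ , extend-⊨ σ⊨KB , refl ∷ All.map⁺ (All.map (λ {ℓ} → from (primeˡ-⇔ ℓ)) σ⊨E)) ,
    entails′
    where
    open Instance I
    E′⊆ : pos t ∷ map primeˡ E ⊆ literals (t ∷ map prime H)
    E′⊆ (here refl) = pos∈ (here refl)
    E′⊆ (there ℓ∈) with ℓ₀ , ℓ₀∈ , refl ← ∈-map⁻ primeˡ ℓ∈ = prime⁺ (E⊆ ℓ₀∈)
    entails′ : ∀ m → m ∈ t ∷ map prime M → ∀ τ → ModelWith (reduce I) (pos t ∷ map primeˡ E) τ → τ m ≡ true
    entails′ _ (here refl) τ (_ , τt ∷ _) = τt
    entails′ _ (there m∈) τ (τN ∷ τ⊨KB , τt ∷ τ⊨E) with m , m∈M , refl ← ∈-map⁻ prime m∈ =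
      entails m m∈M (reflect τ)
        ( reflect-⊨ (force-standard τN τt) τ⊨KB
        , All.map (λ {ℓ} → to (primeˡ-⇔ ℓ)) (All.map⁻ τ⊨E))

  -- The explanation kept consists of the literals whose renamed copies lie in `E′`. Any other
  -- literal of `E′` is on t, and `extend σ` satisfies it.
  complete : ∀ I → Problem.Yes B (reduce I) → Problem.Yes A I
  complete I (E′ , E′⊆ , (τ , τN ∷ τ⊨KB , τ⊨E′) , entails′) =
    E , (λ ℓ∈ → proj₁ (∈-filter⁻ kept? ℓ∈)) ,
    (reflect τ , reflect-⊨ (force-standard τN τt) τ⊨KB , reflect⊨E) , entails
    where
    open Instance I
    kept? : ∀ ℓ → Dec (primeˡ ℓ ∈ E′)
    kept? ℓ = em
    E : List Literal
    E = filter kept? (literals H)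
    τt : τ t ≡ true
    -- Here t is entailed because it is among the manifestations; it need not be a member of `E′`.
    τt = entails′ t (here refl) τ (τN ∷ τ⊨KB , τ⊨E′)
    reflect⊨E : All (reflect τ ⊨ˡ_) E
    reflect⊨E = All.tabulate λ {ℓ} ℓ∈ →
      to (primeˡ-⇔ ℓ) (All.lookup τ⊨E′ (proj₂ (∈-filter⁻ kept? {xs = literals H} ℓ∈)))
    extend⊨E′ : ∀ {σ} → All (σ ⊨ˡ_) E → All (extend σ ⊨ˡ_) E′
    extend⊨E′ σ⊨E = All.tabulate λ ℓ∈ → holds ℓ∈ (prime⁻ (E′⊆ ℓ∈))
      where
      holds : ∀ {ℓ} → ℓ ∈ E′ → (ℓ ≡ pos t ⊎ ℓ ≡ neg t) ⊎ (∃[ ℓ₀ ] ℓ₀ ∈ literals H × ℓ ≡ primeˡ ℓ₀) →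
              extend _ ⊨ˡ ℓ
      holds ℓ∈ (inj₁ (inj₁ refl)) = refl
      -- The negative literal on t cannot be in `E′`, since the model `τ` of `E′` makes t true.
      holds ℓ∈ (inj₁ (inj₂ refl)) = contradiction (trans (sym τt) (All.lookup τ⊨E′ ℓ∈)) λ ()
      holds ℓ∈ (inj₂ (ℓ₀ , ℓ₀∈ , refl)) = from (primeˡ-⇔ ℓ₀) (All.lookup σ⊨E (∈-filter⁺ kept? ℓ₀∈ ℓ∈))
    entails : ∀ m → m ∈ M → ∀ σ → ModelWith I E σ → σ m ≡ true
    entails m m∈ σ (σ⊨KB , σ⊨E) =
      entails′ (prime m) (there (∈-map⁺ prime m∈)) (extend σ) (extend-⊨ σ⊨KB , extend⊨E′ σ⊨E)

  -- Counting the variables of a reduced instance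

  Renamed : List Var → Var → Set
  Renamed xs y = y ∈ constant true ∷ constant false ∷ map prime xs

  renamed-⊆ : ∀ {xs ys y} → xs ⊆ ys → Renamed xs y → Renamed ys y
  renamed-⊆ xs⊆ys (here refl)         = here refl
  renamed-⊆ xs⊆ys (there (here refl)) = there (here refl)
  renamed-⊆ xs⊆ys (there (there y∈)) with x , x∈ , refl ← ∈-map⁻ prime y∈ =
    there (there (∈-map⁺ prime (xs⊆ys x∈)))

  renamed-prime : ∀ {xs ys y} → xs ⊆ ys → y ∈ map prime xs → Renamed ys y
  renamed-prime xs⊆ys y∈ = renamed-⊆ xs⊆ys (there (there y∈))

  renamed-constants : ∀ {n xs} (v : Vec Bool n) → All (Renamed xs) (Vec.toList (Vec.map constant v))
  renamed-constants []          = []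
  renamed-constants (true ∷ v)  = here refl ∷ renamed-constants v
  renamed-constants (false ∷ v) = there (here refl) ∷ renamed-constants v

  renamed-force : ∀ b {x xs} → Renamed xs x → All (Renamed xs) (Vec.toList (Constraint.scope (force b x)))
  renamed-force b {x} x∈ rewrite Vec.toList-++ (Vec.map constant (orient b before)) (x ∷ Vec.map constant (orient b after)) =
    All.++⁺ (renamed-constants (orient b before)) (x∈ ∷ renamed-constants (orient b after))

  renamed-translateAs : ∀ {k} {R : Relation k} (p : (Γ ∪⊥⊤) k R) ts l xs →
                        All (Renamed (Vec.toList xs)) (Vec.toList (Constraint.scope (translateAs p ts l xs)))
  renamed-translateAs (old r) ts l xs rewrite Vec.toList-map prime xs = All.tabulate (λ y∈ → there (there y∈))
  renamed-translateAs (bot _) ts l (x ∷ []) = renamed-force false (there (there (here refl)))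
  renamed-translateAs (top _) ts l (x ∷ []) = renamed-force true (there (there (here refl)))

  scopes : ∀ {Γ} → Formula Γ → List Var
  scopes = concatMap (Vec.toList ∘ Constraint.scope)

  renamed-translate : ∀ φ → All (Renamed (scopes φ)) (scopes (map translate φ))
  renamed-translate []      = []
  renamed-translate (C ∷ φ) = All.++⁺
    (All.map (renamed-⊆ ∈-++⁺ˡ) (renamed-translateAs inΓ tuples listing scope))
    (All.map (renamed-⊆ (∈-++⁺ʳ (Vec.toList scope))) (renamed-translate φ))
    where open Constraint C

  renamed-reduce : ∀ I → All (Renamed (occurrences I)) (occurrences (reduce I))
  renamed-reduce I =
    All.++⁺ (All.++⁺ (renamed-force true (here refl)) (All.map (renamed-⊆ ∈-++⁺ˡ) (renamed-translate KB)))
      (here refl ∷ All.++⁺ (All.tabulate (renamed-prime (∈-++⁺ʳ (scopes KB) ∘ ∈-++⁺ˡ)))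
      (here refl ∷ All.tabulate (renamed-prime (∈-++⁺ʳ (scopes KB) ∘ ∈-++⁺ʳ H))))
    where open Instance I

  -- Renaming adds no distinct variables, so only the two constants account for the summand 2.
  fewVars : ∀ I → #var (reduce I) ≤ #var I + 2
  fewVars I = ≤-trans (Unique-⊆-length (deduplicate-! (occurrences (reduce I))) included)
    (≤-reflexive (trans (cong (2 +_) (length-map prime (deduplicate _≟ᵛ_ (occurrences I)))) (+-comm 2 (#var I))))
    where
    included : deduplicate _≟ᵛ_ (occurrences (reduce I)) ⊆
               constant true ∷ constant false ∷ map prime (deduplicate _≟ᵛ_ (occurrences I))
    included y∈ = renamed-⊆ (∈-deduplicate⁺ _≟ᵛ_)
      (All.lookup (renamed-reduce I) (∈-deduplicate⁻ _≟ᵛ_ (occurrences (reduce I)) y∈))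

  reduction : A ≤CV B
  reduction = record
    { f          = reduce
    ; polynomial = Compile.machine transducer , suc (Compile.bound transducer) , 1 ,
                   λ I → Compile.transduces transducer (reduceʳ I)
    ; correct    = λ I → mk⇔ (sound I) (complete I)
    ; fewVars    = 2 , fewVars
    }

-- The converse reduction, by inclusion of languages

idle : TuringMachine
idle = record
  { State    = ⊤
  ; states   = [ tt ]
  ; complete = λ _ → here refl
  ; start    = tt
  ; extra    = 0
  ; δ        = λ _ _ → nothing
  }

contents-inputTape : ∀ w → contents (inputTape w) ≡ w
contents-inputTape []      = refl
contents-inputTape (s ∷ w) = cong (s ∷_) (mapMaybe-just w)

module Weaken (L : LiteralClass) (Γ : Language) where

  weakenᶜ : Constraint Γ → Constraint (Γ ∪⊥⊤)
  weakenᶜ C = record { inΓ = old inΓ ; tuples = tuples ; listing = listing ; scope = scope }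
    where open Constraint C

  weaken : Instance Γ → Instance (Γ ∪⊥⊤)
  weaken I = record { KB = map weakenᶜ KB ; H = H ; M = M }
    where open Instance I

  reduction : abduction L Γ ≤CV abduction L (Γ ∪⊥⊤)
  reduction = record
    { f          = weaken
    -- Weakening leaves the encoding unchanged, so the machine halts after 0 steps: its only tape
    -- carries both input and output.
    ; polynomial = idle , 0 , 0 , λ I → _ , TuringMachine.halt refl ,
                   trans (contents-inputTape (encodeInstance I)) (sym (encode-weaken I))
    ; correct    = λ I → mk⇔
        (λ (E , E⊆ , (σ , σ⊨KB , σ⊨E) , entails) →
          E , E⊆ , (σ , All.map⁺ σ⊨KB , σ⊨E) , λ m m∈ τ (τ⊨KB , τ⊨E) → entails m m∈ τ (All.map⁻ τ⊨KB , τ⊨E))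
        (λ (E , E⊆ , (σ , σ⊨KB , σ⊨E) , entails) →
          E , E⊆ , (σ , All.map⁻ σ⊨KB , σ⊨E) , λ m m∈ τ (τ⊨KB , τ⊨E) → entails m m∈ τ (All.map⁺ τ⊨KB , τ⊨E))
    ; fewVars    = 0 , λ I → ≤-trans (≤-reflexive (#var-weaken I)) (m≤m+n _ 0)
    }
    where
    encode-weaken : ∀ I → encodeInstance (weaken I) ≡ encodeInstance I
    encode-weaken I = cong (λ w → bracket w ++ encodeList encodeWord H ++ encodeList encodeWord M)
      (concatMap-map encodeConstraint weakenᶜ KB)
      where open Instance I
    #var-weaken : ∀ I → #var (weaken I) ≡ #var I
    #var-weaken I = cong (λ xs → length (deduplicate _≟ᵛ_ (xs ++ H ++ M)))
      (concatMap-map (Vec.toList ∘ Constraint.scope) weakenᶜ KB)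
      where open Instance I

theorem28 : ExcludedMiddle 0ℓ → (Γ : Language) → Pol Γ ≐ [x̄] →
    ((ABD (Γ ∪⊥⊤) ≤CV ABD Γ) × (ABD Γ ≤CV ABD (Γ ∪⊥⊤))) ×
    ((P-ABD (Γ ∪⊥⊤) ≤CV P-ABD Γ) × (P-ABD Γ ≤CV P-ABD (Γ ∪⊥⊤)))
theorem28 em Γ Pol≐ =
  (addConstants allLiterals , Weaken.reduction allLiterals Γ) ,
  (addConstants positiveLiterals , Weaken.reduction positiveLiterals Γ)
  where
  addConstants : ∀ L → abduction L (Γ ∪⊥⊤) ≤CV abduction L Γ
  addConstants L = AddConstants.reduction em L (complementClosed Pol≐) (findForcing em Pol≐)
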